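{- Let $r = 2k+1 \geq 5$ be an odd integer, let $n$ be a positive integer divisible by $r$, and let $\nu_n = (1,2,\ldots,n)$ be the natural cyclic order on $\{1,\ldots,n\}$. Then $$mbt\bigl(C(n,\{1,2,\ldots,k\}),\nu_n\bigr) = 2k+1.$$
   Context: All graphs are finite and simple. For a set $S=\{i_1<\cdots<i_k\}$ of integers with $k\ge 1$, $1\le i_1$ and $i_k\le \lfloor n/2\rfloor$, the circulant $C(n,S)$ is the graph on vertex set $\{1,\ldots,n\}$ in which each $j$ is adjacent to $j+i_r$ (addition mod $n$) for $r=1,\ldots,k$. Given a graph $G$ and a cyclic order $\omega$ on $V(G)$, draw the vertices on a circle in the order $\omega$ and the edges as straight chords; two edges cross if they intersect at a point that is not an endpoint. A matching book embedding $(G,\omega,c)$ consists of $G$, a cyclic order $\omega$, and an edge-coloring $c$ (the color classes are the pages) such that any two distinct edges of the same color neither cross nor share an endpoint. The number $mbt(G,\omega)$ is the least number of colors in any matching book embedding $(G,\omega,c)$ with the given cyclic order $\omega$. -}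

module Defs where

open import Data.Fin.Base as Fin using (Fin; toℕ)
open import Data.Fin.Permutation as Perm using (Permutation′; _⟨$⟩ˡ_)
open import Data.List.Base using (List; []; length; applyUpTo)
open import Data.List.Properties using (length-applyUpTo)
open import Data.List.Relation.Unary.All as All using (All)
import Data.List.Relation.Unary.All.Properties as All
open import Data.List.Relation.Unary.Any using (Any; any?)
open import Data.List.Relation.Unary.Linked using (Linked)
import Data.List.Relation.Unary.Linked.Properties as Linked
open import Data.Nat.Base
open import Data.Nat.Divisibility using (_∣_; _∣?_; ∣⇒≤; >⇒∤)
open import Data.Nat.Properties
open import Data.Product.Base using (_×_; _,_; ∃-syntax)
open import Data.Sum.Base using (_⊎_; [_,_]; swap)
open import Level using (0ℓ)
open import Relation.Binary.Core using (Rel)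
open import Relation.Binary.Definitions using (Symmetric; Irreflexive; Decidable)
open import Relation.Binary.PropositionalEquality
  using (_≡_; _≢_; refl; sym; trans; cong; subst)
open import Relation.Nullary using (¬_)
open import Relation.Nullary.Decidable using (_⊎-dec_)

------------------------------------------------------------------------
-- Finite simple graphs

record Graph (n : ℕ) : Set₁ where
  field
    Adj    : Rel (Fin n) 0ℓ
    adj?   : Decidable Adj
    symm   : Symmetric Adj
    irrefl : Irreflexive _≡_ Adj

-- An unordered edge, stored with its smaller endpoint first.  The proofs
-- are irrelevant, so that two edges are equal (_≡_) as soon as they have
-- the same endpoints; adj? makes the adjacency proof recoverable.
record Edge {n : ℕ} (G : Graph n) : Set where
  constructor edge
  field
    src tgt  : Fin n
    .src<tgt : src Fin.< tgt
    .adj     : Graph.Adj G src tgt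

open Edge public using (src; tgt)

module _ {n : ℕ} {G : Graph n} where

  _∈ₑ_ : Fin n → Edge G → Set
  v ∈ₑ e = v ≡ src e ⊎ v ≡ tgt e

  ShareEndpoint : Rel (Edge G) 0ℓ
  ShareEndpoint e f = ∃[ v ] (v ∈ₑ e × v ∈ₑ f)

------------------------------------------------------------------------
-- Cyclic orders and matching book embeddings

-- A cyclic order (v₁, …, vₙ) is given by the bijection p ↦ vₚ from
-- positions to vertices.  Rotated listings denote the same cyclic order;
-- they induce the same relation Clockwise below.
CyclicOrder : ℕ → Set
CyclicOrder = Permutation′

natural : (n : ℕ) → CyclicOrder n
natural n = Perm.id

position : ∀ {n} → CyclicOrder n → Fin n → Fin n
position ω v = ω ⟨$⟩ˡ v

-- Travelling around the circle from u, one meets v strictly before w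
-- (u, v, w distinct); that is, v lies on the open arc from u to w.
Clockwise : ∀ {n} → CyclicOrder n → (u v w : Fin n) → Set
Clockwise ω u v w = (a Fin.< b × b Fin.< c)
                  ⊎ (b Fin.< c × c Fin.< a)
                  ⊎ (c Fin.< a × a Fin.< b)
  where
  a = position ω u
  b = position ω v
  c = position ω w

-- Distinct straight chords of a circle meet at a point other than an
-- endpoint exactly when the endpoints of one lie on different open arcs
-- cut off by the other.
Cross : ∀ {n} {G : Graph n} → CyclicOrder n → Rel (Edge G) 0ℓ
Cross ω e f =
    (Clockwise ω (src e) (src f) (tgt e) × Clockwise ω (tgt e) (tgt f) (src e))
  ⊎ (Clockwise ω (src e) (tgt f) (tgt e) × Clockwise ω (tgt e) (src f) (src e))

record MatchingBookEmbedding {n : ℕ} (G : Graph n) (ω : CyclicOrder n)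
                             (pages : ℕ) : Set where
  field
    colour      : Edge G → Fin pages
    noncrossing : ∀ e f → e ≢ f → colour e ≡ colour f → ¬ Cross ω e f
    matching    : ∀ e f → e ≢ f → colour e ≡ colour f → ¬ ShareEndpoint e f

-- mbt(G, ω) = m.
record IsMbt {n : ℕ} (G : Graph n) (ω : CyclicOrder n) (m : ℕ) : Set where
  field
    attained : MatchingBookEmbedding G ω m
    least    : ∀ m′ → MatchingBookEmbedding G ω m′ → m ≤ m′

------------------------------------------------------------------------
-- Circulants

infix 4 _≡_[mod_]

_≡_[mod_] : ℕ → ℕ → ℕ → Set
a ≡ b [mod n ] = n ∣ ∣ a - b ∣

-- The sets S = {i₁ < ⋯ < iₖ} with k ≥ 1, 1 ≤ i₁ and iₖ ≤ ⌊n/2⌋.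
record JumpSet (n : ℕ) : Set where
  field
    elements   : List ℕ
    increasing : Linked _<_ elements
    nonempty   : 1 ≤ length elements
    positive   : All (1 ≤_) elements
    bounded    : All (_≤ ⌊ n /2⌋) elements

-- Fin n stands for the vertex set {1, …, n}.
label : ∀ {n} → Fin n → ℕ
label j = suc (toℕ j)

module _ (n : ℕ) (S : JumpSet n) where
  open JumpSet S

  Jump : Rel (Fin n) 0ℓ
  Jump u v = Any (λ s → label u + s ≡ label v [mod n ]) elements

  private
    no-loop : ∀ {s} (j : Fin n) → 1 ≤ s × s ≤ ⌊ n /2⌋ →
              ¬ (label j + s ≡ label j [mod n ])
    no-loop {s@(suc _)} j (_ , s≤n/2) n∣d =
      >⇒∤ (s<n n s≤n/2) (subst (n ∣_) (∣m+n-m∣≡n (label j) s) n∣d)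
      where
      ∣m+n-m∣≡n : ∀ m n → ∣ m + n - m ∣ ≡ n
      ∣m+n-m∣≡n m n = trans (∣-∣-comm (m + n) m) (∣m-m+n∣≡n m n)

      s<n : ∀ n → s ≤ ⌊ n /2⌋ → s < n
      s<n (suc n) s≤ = ≤-<-trans s≤ (⌊n/2⌋<n n)

    Jump-irrefl : ∀ j → ¬ Jump j j
    Jump-irrefl j jj =
      let (s-ok , d) = All.lookupAny (All.zip (positive , bounded)) jj
      in no-loop j s-ok d

    Jump? : Decidable Jump
    Jump? u v = any? (λ s → n ∣? ∣ label u + s - label v ∣) elements

  circulant : Graph n
  circulant = record
    { Adj    = λ u v → Jump u v ⊎ Jump v u
    ; adj?   = λ u v → Jump? u v ⊎-dec Jump? v u
    ; symm   = swap
    ; irrefl = λ { {j} refl → [ Jump-irrefl j , Jump-irrefl j ] }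
    }

-- S = {1, 2, …, k}
oneUpTo : ∀ {n} k → 1 ≤ k → k ≤ ⌊ n /2⌋ → JumpSet n
oneUpTo k 1≤k k≤n/2 = record
  { elements   = applyUpTo suc k
  ; increasing = Linked.applyUpTo⁺₂ suc k (λ i → n<1+n (suc i))
  ; nonempty   = subst (1 ≤_) (sym (length-applyUpTo suc k)) 1≤k
  ; positive   = All.applyUpTo⁺₂ suc k (λ _ → s≤s z≤n)
  ; bounded    = All.applyUpTo⁺₁ suc k (λ i<k → ≤-trans i<k k≤n/2)
  }

5≤2k+1⇒1≤k : ∀ k → 5 ≤ 2 * k + 1 → 1 ≤ k
5≤2k+1⇒1≤k zero    (s≤s ())
5≤2k+1⇒1≤k (suc k) _ = s≤s z≤n

2k+1∣n⇒k≤n/2 : ∀ k n .{{_ : NonZero n}} → 2 * k + 1 ∣ n → k ≤ ⌊ n /2⌋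
2k+1∣n⇒k≤n/2 k n r∣n = begin
  k              ≡⟨ n≡⌊n+n/2⌋ k ⟩
  ⌊ k + k /2⌋    ≤⟨ ⌊n/2⌋-mono 2k≤n ⟩
  ⌊ n /2⌋        ∎
  where
  open ≤-Reasoning
  2k≤n : k + k ≤ n
  2k≤n = begin
    k + k        ≡⟨ cong (k +_) (+-identityʳ k) ⟨
    2 * k        ≤⟨ m≤m+n (2 * k) 1 ⟩
    2 * k + 1    ≤⟨ ∣⇒≤ r∣n ⟩
    n            ∎

{-# OPTIONS --safe #-}

-- Upper bound: colour the edge ab by a + b modulo r = 2k+1.  Two edges ab, cd
-- that cross or meet can be listed so that a ≤ c ≤ b ≤ d.  These points cut the
-- circle into four gaps p, q, t, w, and both p + t and −(q + w) represent the
-- difference of the two colours.  As each edge spans two adjacent gaps of total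
-- at most k, one of p + t, q + w is at most 2k, so the colours differ.
--
-- Lower bound: the 2k edges at a vertex v together with the edge joining the
-- two circle neighbours of v pairwise cross or meet.

module Submission where

open import Defs
open import Data.Fin.Base as Fin using (Fin; toℕ; fromℕ<)
open import Data.Fin.Properties using (toℕ<n; toℕ-fromℕ<; toℕ-injective; pigeonhole)
open import Data.List.Relation.Unary.Any.Properties using (applyUpTo⁺; applyUpTo⁻)
open import Data.Nat.Base
open import Data.Nat.Divisibility
  using (_∣_; divides; divides-refl; _∣0; ∣⇒≤; >⇒∤; ∣m+n∣m⇒∣n)
open import Data.Nat.DivMod
open import Data.Nat.Properties
open import Data.Nat.Tactic.RingSolver using (solve-∀)
open import Data.Product.Base using (_×_; _,_; proj₁; proj₂; ∃-syntax)
open import Data.Sum.Base using (_⊎_; inj₁; inj₂)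
open import Data.Empty using (⊥-elim)
open import Function.Base using (_∘_)
open import Relation.Binary.Definitions using (tri<; tri≈; tri>)
open import Relation.Binary.PropositionalEquality
open import Relation.Nullary using (¬_; yes; no; contradiction)
open import Relation.Nullary.Decidable using (recompute)

-- Sums of endpoints modulo r and gaps on the circle

%-≡⇒∣ : ∀ x d r .{{_ : NonZero r}} → x % r ≡ (x + d) % r → r ∣ d
%-≡⇒∣ x d r eq = ∣m+n∣m⇒∣n (divides ((x + d) / r) [x/r]*r+d≡) (divides-refl (x / r))
  where
  open ≡-Reasoning
  [x/r]*r+d≡ : x / r * r + d ≡ (x + d) / r * r
  [x/r]*r+d≡ = +-cancelˡ-≡ (x % r) _ _ (begin
    x % r + (x / r * r + d)            ≡⟨ +-assoc (x % r) _ d ⟨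
    x % r + x / r * r + d              ≡⟨ cong (_+ d) (m≡m%n+[m/n]*n x r) ⟨
    x + d                              ≡⟨ m≡m%n+[m/n]*n (x + d) r ⟩
    (x + d) % r + (x + d) / r * r      ≡⟨ cong (_+ (x + d) / r * r) eq ⟨
    x % r + (x + d) / r * r            ∎)

-- In each of the four cases the two bounded pairs have exactly one gap in common. The other gap of
-- each pair is then at most `k`, and these two gaps are opposite.
opposite-gaps : ∀ {k} p q t w → p + q ≤ k ⊎ t + w ≤ k → q + t ≤ k ⊎ w + p ≤ k →
                p + t ≤ k + k ⊎ q + w ≤ k + k
opposite-gaps p q t w (inj₁ pq) (inj₁ qt) =
  inj₁ (+-mono-≤ (m+n≤o⇒m≤o p pq) (m+n≤o⇒n≤o q qt))
opposite-gaps p q t w (inj₁ pq) (inj₂ wp) =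
  inj₂ (+-mono-≤ (m+n≤o⇒n≤o p pq) (m+n≤o⇒m≤o w wp))
opposite-gaps p q t w (inj₂ tw) (inj₁ qt) =
  inj₂ (+-mono-≤ (m+n≤o⇒m≤o q qt) (m+n≤o⇒n≤o t tw))
opposite-gaps p q t w (inj₂ tw) (inj₂ wp) =
  inj₁ (+-mono-≤ (m+n≤o⇒n≤o w wp) (m+n≤o⇒m≤o t tw))

-- For a < b < n: the distance from a to b around an n-cycle is at most k.
Near : (n k a b : ℕ) → Set
Near n k a b = b ≤ a + k ⊎ a + n ≤ b + k

interleaved-sums-≢ :
  ∀ {n k r} .{{_ : NonZero r}} {a b c d} → k + k < r → r ∣ n →
  a ≤ c → c ≤ b → b ≤ d → d < n → a < c ⊎ b < d →
  Near n k a b → Near n k c d → (a + b) % r ≢ (c + d) % r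
interleaved-sums-≢ {n} {k} {r} {a} {b} {c} {d} 2k<r r∣n a≤c c≤b b≤d d<n distinct ab cd same
  with p , refl ← m≤n⇒∃[o]m+o≡n a≤c
  with q , refl ← m≤n⇒∃[o]m+o≡n c≤b
  with t , refl ← m≤n⇒∃[o]m+o≡n b≤d
  with w , refl ← m≤n⇒∃[o]m+o≡n (<⇒≤ d<n)
  -- Here `w` runs only from `d` to `n`, which is the point 0 again, so the gap from `d` round to
  -- `a` is `w + a`.
  with opposite-gaps p q t (w + a) (gaps-ab ab) (gaps-cd cd)
  where
  gaps-ab : ∀ {p q t w} → Near (a + p + q + t + w) k a (a + p + q) →
            p + q ≤ k ⊎ t + (w + a) ≤ k
  gaps-ab {p} {q} (inj₁ short) =
    inj₁ (+-cancelˡ-≤ a _ _ (subst (_≤ a + k) (+-assoc a p q) short))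
  gaps-ab {p} {q} {t} {w} (inj₂ long) =
    inj₂ (+-cancelˡ-≤ (a + p + q) _ _ (subst (_≤ a + p + q + k) (lemma a p q t w) long))
    where
    lemma : ∀ a p q t w → a + (a + p + q + t + w) ≡ a + p + q + (t + (w + a))
    lemma = solve-∀

  gaps-cd : ∀ {p q t w} → Near (a + p + q + t + w) k (a + p) (a + p + q + t) →
            q + t ≤ k ⊎ w + a + p ≤ k
  gaps-cd {p} {q} {t} (inj₁ short) =
    inj₁ (+-cancelˡ-≤ (a + p) _ _ (subst (_≤ a + p + k) (+-assoc (a + p) q t) short))
  gaps-cd {p} {q} {t} {w} (inj₂ long) =
    inj₂ (+-cancelˡ-≤ (a + p + q + t) _ _
           (subst (_≤ a + p + q + t + k) (lemma a p q t w) long))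
    where
    lemma : ∀ a p q t w → a + p + (a + p + q + t + w) ≡ a + p + q + t + (w + a + p)
    lemma = solve-∀
-- Since c + d = (a + b) + (p + t), equal residues make `r` divide `p + t`, which `distinct` keeps
-- positive and which is below `r`.
... | inj₁ p+t≤2k =
  >⇒∤ {{>-nonZero (0<p+t distinct)}} (≤-<-trans p+t≤2k 2k<r)
      (%-≡⇒∣ (a + (a + p + q)) (p + t) r
        (trans same (cong (_% r) (lemma a p q t))))
  where
  lemma : ∀ a p q t → a + p + (a + p + q + t) ≡ a + (a + p + q) + (p + t)
  lemma = solve-∀

  m<m+o⇒0<o : ∀ m {o} → m < m + o → 0 < o
  m<m+o⇒0<o m m<m+o = +-cancelˡ-< m _ _ (subst (_< m + _) (sym (+-identityʳ m)) m<m+o)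

  0<p+t : a < a + p ⊎ a + p + q < a + p + q + t → 0 < p + t
  0<p+t (inj₁ a<c) = ≤-trans (m<m+o⇒0<o a a<c) (m≤m+n p t)
  0<p+t (inj₂ b<d) = ≤-trans (m<m+o⇒0<o (a + p + q) b<d) (m≤n+m t p)
... | inj₂ q+w≤2k =
  >⇒∤ {{>-nonZero 0<q+w}} (≤-<-trans q+w≤2k 2k<r)
      (%-≡⇒∣ (a + p + (a + p + q + t)) (q + (w + a)) r (begin
        (a + p + (a + p + q + t)) % r                  ≡⟨ same ⟨
        -- As `r` divides `n`, adding `n` keeps the residue; a + b + n then exceeds c + d by exactly
        -- the other pair of gaps.
        (a + (a + p + q)) % r                          ≡⟨ %-remove-+ʳ (a + (a + p + q)) r∣n ⟨
        (a + (a + p + q) + (a + p + q + t + w)) % r    ≡⟨ cong (_% r) (lemma a p q t w) ⟩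
        (a + p + (a + p + q + t) + (q + (w + a))) % r  ∎))
  where
  open ≡-Reasoning
  lemma : ∀ a p q t w → a + (a + p + q) + (a + p + q + t + w)
                      ≡ a + p + (a + p + q + t) + (q + (w + a))
  lemma = solve-∀

  0<w : 0 < w
  0<w = +-cancelˡ-< (a + p + q + t) _ _
          (subst (_< a + p + q + t + w) (sym (+-identityʳ (a + p + q + t))) d<n)

  0<q+w : 0 < q + (w + a)
  0<q+w = ≤-trans 0<w (≤-trans (m≤m+n w a) (m≤n+m (w + a) q))

-- Crossing or meeting edges in linear order

module _ {n : ℕ} {G : Graph n} where

  Touch : Edge G → Edge G → Set
  Touch e f = Cross (natural n) e f ⊎ ShareEndpoint e f

  -- The inequalities are weak so that one relation covers both crossing edges and edges with a
  -- common endpoint.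
  Interleaved : Edge G → Edge G → Set
  Interleaved e f = src e Fin.≤ src f × src f Fin.≤ tgt e × tgt e Fin.≤ tgt f

  src<tgt : (e : Edge G) → src e Fin.< tgt e
  src<tgt (edge u v u<v _) = recompute (_ <? _) u<v

  -- Let `e` join a < b and `f` join c < d. Only the orders a < c < b < d and c < a < d < b are
  -- compatible with the cyclic conditions; every other case closes a cycle of strict inequalities.
  cross⇒interleaved : ∀ e f → Cross (natural n) e f → Interleaved e f ⊎ Interleaved f e
  cross⇒interleaved e f = go (src<tgt e) (src<tgt f)
    where
    go : src e Fin.< tgt e → src f Fin.< tgt f →
         Cross (natural n) e f → Interleaved e f ⊎ Interleaved f e
    go a<b c<d (inj₁ (inj₁ (a<c , c<b) , inj₁ (b<d , d<a))) =
      ⊥-elim (<-asym a<b (<-trans b<d d<a))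
    go a<b c<d (inj₁ (inj₁ (a<c , c<b) , inj₂ (inj₁ (d<a , _)))) =
      ⊥-elim (<-asym a<c (<-trans c<d d<a))
    go a<b c<d (inj₁ (inj₁ (a<c , c<b) , inj₂ (inj₂ (_ , b<d)))) =
      inj₁ (<⇒≤ a<c , <⇒≤ c<b , <⇒≤ b<d)
    go a<b c<d (inj₁ (inj₂ (inj₁ (c<b , b<a)) , _)) = ⊥-elim (<-asym a<b b<a)
    go a<b c<d (inj₁ (inj₂ (inj₂ (b<a , _)) , _)) = ⊥-elim (<-asym a<b b<a)
    go a<b c<d (inj₂ (inj₁ (a<d , d<b) , inj₁ (b<c , c<a))) =
      ⊥-elim (<-asym a<b (<-trans b<c c<a))
    go a<b c<d (inj₂ (inj₁ (a<d , d<b) , inj₂ (inj₁ (c<a , _)))) =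
      inj₂ (<⇒≤ c<a , <⇒≤ a<d , <⇒≤ d<b)
    go a<b c<d (inj₂ (inj₁ (a<d , d<b) , inj₂ (inj₂ (_ , b<c)))) =
      ⊥-elim (<-asym d<b (<-trans b<c c<d))
    go a<b c<d (inj₂ (inj₂ (inj₁ (d<b , b<a)) , _)) = ⊥-elim (<-asym a<b b<a)
    go a<b c<d (inj₂ (inj₂ (inj₂ (b<a , _)) , _)) = ⊥-elim (<-asym a<b b<a)

  share⇒interleaved : ∀ e f → ShareEndpoint e f → Interleaved e f ⊎ Interleaved f e
  share⇒interleaved e f (v , inj₁ refl , inj₁ refl) with ≤-total (toℕ (tgt e)) (toℕ (tgt f))
  ... | inj₁ b≤d = inj₁ (≤-refl , <⇒≤ (src<tgt e) , b≤d)
  ... | inj₂ d≤b = inj₂ (≤-refl , <⇒≤ (src<tgt f) , d≤b)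
  share⇒interleaved e f (v , inj₁ refl , inj₂ refl) =
    inj₂ (<⇒≤ (src<tgt f) , ≤-refl , <⇒≤ (src<tgt e))
  share⇒interleaved e f (v , inj₂ refl , inj₁ refl) =
    inj₁ (<⇒≤ (src<tgt e) , ≤-refl , <⇒≤ (src<tgt f))
  share⇒interleaved e f (v , inj₂ refl , inj₂ refl) with ≤-total (toℕ (src e)) (toℕ (src f))
  ... | inj₁ a≤c = inj₁ (a≤c , <⇒≤ (src<tgt f) , ≤-refl)
  ... | inj₂ c≤a = inj₂ (c≤a , <⇒≤ (src<tgt e) , ≤-refl)

  edge-≡ : (e f : Edge G) → src e ≡ src f → tgt e ≡ tgt f → e ≡ f
  edge-≡ (edge _ _ _ _) (edge _ _ _ _) refl refl = refl

  -- Supplies the strictness that makes `p + t` positive in `interleaved-sums-≢`.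
  interleaved-distinct : ∀ e f → e ≢ f → Interleaved e f →
                         src e Fin.< src f ⊎ tgt e Fin.< tgt f
  interleaved-distinct e f e≢f (a≤c , _ , b≤d)
    with m≤n⇒m<n∨m≡n a≤c | m≤n⇒m<n∨m≡n b≤d
  ... | inj₁ a<c | _        = inj₁ a<c
  ... | _        | inj₁ b<d = inj₂ b<d
  ... | inj₂ a≡c | inj₂ b≡d =
    contradiction (edge-≡ e f (toℕ-injective a≡c) (toℕ-injective b≡d)) e≢f

-- Edges of the circulant and the colouring by endpoint sums

module _ {n k : ℕ} (1≤k : 1 ≤ k) (k≤n/2 : k ≤ ⌊ n /2⌋) where

  private
    S = oneUpTo k 1≤k k≤n/2
    G = circulant n S

  -- A jump from `u` to the larger `v` that fell short of `v` would leave a positive multiple of `n`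
  -- smaller than `n`. A jump from `v` to `u` must wrap around, since `v + suc i - u` is a positive
  -- multiple of `n`.
  adj⇒near : ∀ {u v} → u Fin.< v → Graph.Adj G u v → Near n k (toℕ u) (toℕ v)
  adj⇒near {u} {v} u<v (inj₁ jump) with applyUpTo⁻ suc jump | toℕ v ≤? toℕ u + k
  ... | _ | yes v≤u+k = inj₁ v≤u+k
  ... | i , i<k , n∣d | no v≰u+k =
    contradiction (subst (n ∣_) (m≤n⇒∣m-n∣≡n∸m (<⇒≤ u+s<v)) n∣d)
                  (>⇒∤ {{>-nonZero (m<n⇒0<n∸m u+s<v)}}
                       (≤-<-trans (m∸n≤m (toℕ v) (toℕ u + suc i)) (toℕ<n v)))
    where
    u+s<v : toℕ u + suc i < toℕ v
    u+s<v = ≤-<-trans (+-monoʳ-≤ (toℕ u) i<k) (≰⇒> v≰u+k)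
  adj⇒near {u} {v} u<v (inj₂ jump) with i , i<k , n∣d ← applyUpTo⁻ suc jump = inj₂ (begin
    toℕ u + n                        ≤⟨ +-monoʳ-≤ (toℕ u) n≤ ⟩
    toℕ u + (toℕ v + suc i ∸ toℕ u)  ≡⟨ m+[n∸m]≡n (<⇒≤ u<v+s) ⟩
    toℕ v + suc i                    ≤⟨ +-monoʳ-≤ (toℕ v) i<k ⟩
    toℕ v + k                        ∎)
    where
    open ≤-Reasoning
    u<v+s : toℕ u < toℕ v + suc i
    u<v+s = ≤-trans u<v (m≤m+n (toℕ v) (suc i))
    n≤ : n ≤ toℕ v + suc i ∸ toℕ u
    n≤ = ∣⇒≤ {{>-nonZero (m<n⇒0<n∸m u<v+s)}}
             (subst (n ∣_) (m≤n⇒∣n-m∣≡n∸m (<⇒≤ u<v+s)) n∣d)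

  edge-near : (e : Edge G) → Near n k (toℕ (src e)) (toℕ (tgt e))
  edge-near e@(edge u v _ adj) = adj⇒near (src<tgt e) (recompute (Graph.adj? G u v) adj)

  sum-colouring : ∀ r .{{_ : NonZero r}} → k + k < r → r ∣ n →
                  MatchingBookEmbedding G (natural n) r
  sum-colouring r 2k<r r∣n = record
    { colour      = colour
    ; noncrossing = λ e f e≢f same → separate e f e≢f same ∘ cross⇒interleaved e f
    ; matching    = λ e f e≢f same → separate e f e≢f same ∘ share⇒interleaved e f
    }
    where
    colour : Edge G → Fin r
    -- Using `toℕ` instead of `label` shifts every sum by 2, which only permutes the colours.
    colour e = (toℕ (src e) + toℕ (tgt e)) mod r

    toℕ-colour : ∀ e → toℕ (colour e) ≡ (toℕ (src e) + toℕ (tgt e)) % r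
    toℕ-colour e = toℕ-fromℕ< _

    not-interleaved : ∀ e f → e ≢ f → colour e ≡ colour f → ¬ Interleaved e f
    not-interleaved e f e≢f same i@(a≤c , c≤b , b≤d) =
      interleaved-sums-≢ 2k<r r∣n a≤c c≤b b≤d (toℕ<n (tgt f))
        (interleaved-distinct e f e≢f i) (edge-near e) (edge-near f)
        (trans (sym (toℕ-colour e)) (trans (cong toℕ same) (toℕ-colour f)))

    separate : ∀ e f → e ≢ f → colour e ≡ colour f → ¬ (Interleaved e f ⊎ Interleaved f e)
    separate e f e≢f same (inj₁ i) = not-interleaved e f e≢f same i
    separate e f e≢f same (inj₂ i) = not-interleaved f e (e≢f ∘ sym) (sym same) i

  chord : (u v : Fin n) → u Fin.< v → toℕ v ≤ toℕ u + k → Edge G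
  chord u v u<v v≤u+k = edge u v u<v (inj₁ (applyUpTo⁺ suc n∣d i<k))
    where
    -- The jump set lists `suc i` for `i < k`, so the jump v - u has index one less.
    i = pred (toℕ v ∸ toℕ u)
    1+i≡v∸u : suc i ≡ toℕ v ∸ toℕ u
    1+i≡v∸u = suc-pred (toℕ v ∸ toℕ u) {{>-nonZero (m<n⇒0<n∸m u<v)}}
    i<k : i < k
    i<k = subst (_≤ k) (sym 1+i≡v∸u) (m≤n+o⇒m∸n≤o (toℕ v) (toℕ u) v≤u+k)
    n∣d : n ∣ ∣ toℕ u + suc i - toℕ v ∣
    n∣d = subst (n ∣_) (sym (m≡n⇒∣m-n∣≡0 u+1+i≡v)) (n ∣0)
      where
      u+1+i≡v : toℕ u + suc i ≡ toℕ v
      u+1+i≡v = trans (cong (toℕ u +_) 1+i≡v∸u) (m+[n∸m]≡n (<⇒≤ u<v))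

-- Lower bound from pairwise touching edges

pairwise-touching-≤ :
  ∀ {n m} {G : Graph n} (es : Fin m → Edge G) →
  (∀ {i j} → i Fin.< j → es i ≢ es j × Touch (es i) (es j)) →
  ∀ m′ → MatchingBookEmbedding G (natural n) m′ → m ≤ m′
pairwise-touching-≤ {m = m} es touching m′ emb with m ≤? m′
... | yes m≤m′ = m≤m′
... | no  m≰m′
  -- With fewer than `m` pages two of the edges get the same page; their indices come out ordered,
  -- so `touching` is only asked for `i < j`.
  with i , j , i<j , same ← pigeonhole (≰⇒> m≰m′) (MatchingBookEmbedding.colour emb ∘ es)
  with touching i<j
... | e≢f , inj₁ crossing =
  contradiction crossing (MatchingBookEmbedding.noncrossing emb _ _ e≢f same)
... | e≢f , inj₂ sharing  =
  contradiction sharing (MatchingBookEmbedding.matching emb _ _ e≢f same)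

-- With v = k no edge at v wraps around; its neighbours are the other numbers up to 2k.
module _ {n l : ℕ} (1≤l : 1 ≤ l) (k≤n/2 : suc l ≤ ⌊ n /2⌋) (2k<n : 2 * suc l < n) where

  private
    k = suc l
    G = circulant n (oneUpTo k (s≤s z≤n) k≤n/2)

    1+k≤2k : suc k ≤ 2 * k
    1+k≤2k = subst (_≤ 2 * k) (+-comm k 1) (+-monoʳ-≤ k (s≤s z≤n))

    vertex : ∀ i → i ≤ 2 * k → Fin n
    vertex i i≤2k = fromℕ< (≤-<-trans i≤2k 2k<n)

    -- An index `i` other than `k` stands for the edge between `i` and the centre `k`. The index `k`
    -- itself, which would give a loop, is assigned to the edge joining the circle neighbours `l`
    -- and `suc k`.
    data Spoke (i : ℕ) (e : Edge G) : Set where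
      before : i < k → toℕ (src e) ≡ i → toℕ (tgt e) ≡ k → Spoke i e
      across : i ≡ k → toℕ (src e) ≡ l → toℕ (tgt e) ≡ suc k → Spoke i e
      after  : k < i → toℕ (src e) ≡ k → toℕ (tgt e) ≡ i → Spoke i e

    chord′ : ∀ {i j} → i < j → j ≤ i + k → j ≤ 2 * k →
             ∃[ e ] (toℕ (src {G = G} e) ≡ i × toℕ (tgt e) ≡ j)
    chord′ {i} {j} i<j j≤i+k j≤2k =
      chord (s≤s z≤n) k≤n/2 u v
        (subst₂ _<_ (sym u≡i) (sym v≡j) i<j)
        (subst₂ (λ x y → y ≤ x + k) (sym u≡i) (sym v≡j) j≤i+k)
      , u≡i , v≡j
      where
      u = vertex i (≤-trans (<⇒≤ i<j) j≤2k)
      v = vertex j j≤2k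
      u≡i : toℕ u ≡ i
      u≡i = toℕ-fromℕ< _
      v≡j : toℕ v ≡ j
      v≡j = toℕ-fromℕ< _

    spoke : ∀ i → i ≤ 2 * k → ∃[ e ] Spoke i e
    spoke i i≤2k with <-cmp i k
    ... | tri< i<k _ _ =
      let e , s , t = chord′ i<k (m≤n+m k i) (<⇒≤ 1+k≤2k) in e , before i<k s t
    ... | tri≈ _ i≡k _ =
      -- This jump has length 2, so it requires `k` to be at least 2, which is `1≤l`.
      let e , s , t = chord′ (m<n⇒m<1+n (n<1+n l)) (+-monoˡ-≤ k 1≤l) 1+k≤2k
      in e , across i≡k s t
    ... | tri> _ _ k<i =
      let e , s , t = chord′ k<i (subst (i ≤_) (cong (k +_) (+-identityʳ k)) i≤2k) i≤2k
      in e , after k<i s t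

    share-≡ : (e f : Edge G) {u v : Fin n} → _∈ₑ_ {G = G} u e → _∈ₑ_ {G = G} v f →
              toℕ u ≡ toℕ v → ShareEndpoint e f
    share-≡ e f {u} u∈e v∈f u≡v = u , u∈e , subst (_∈ₑ f) (sym (toℕ-injective u≡v)) v∈f

    -- Two edges at the centre meet there. The edge from `l` to `suc k` passes over the centre, so
    -- it crosses each edge at the centre, except those ending at `l` or `suc k`, with which it
    -- shares that endpoint.
    spokes-touch : ∀ {i j} (e f : Edge G) → i < j → Spoke i e → Spoke j f → e ≢ f × Touch e f
    spokes-touch e f i<j (before i<k refl b≡k) (before j<k refl d≡k) =
      (λ { refl → <-irrefl refl i<j }) ,
      inj₂ (share-≡ e f (inj₂ refl) (inj₂ refl) (trans b≡k (sym d≡k)))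
    spokes-touch {i} e f i<j (before i<k refl b≡k) (across refl c≡l d≡k+1)
      with m≤n⇒m<n∨m≡n (s≤s⁻¹ i<k)
    ... | inj₁ i<l =
      (λ { refl → <-irrefl (trans (sym b≡k) d≡k+1) (n<1+n k) }) ,
      inj₁ (inj₁ ( inj₁ (subst (i <_) (sym c≡l) i<l
                        , subst₂ _<_ (sym c≡l) (sym b≡k) (n<1+n l))
                 , inj₂ (inj₂ (subst (i <_) (sym b≡k) i<k
                              , subst₂ _<_ (sym b≡k) (sym d≡k+1) (n<1+n k)))))
    ... | inj₂ i≡l =
      (λ { refl → <-irrefl (trans (sym b≡k) d≡k+1) (n<1+n k) }) ,
      inj₂ (share-≡ e f (inj₁ refl) (inj₁ refl) (trans i≡l (sym c≡l)))
    spokes-touch e f i<j (before i<k refl b≡k) (after k<j c≡k refl) =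
      (λ { refl → <-irrefl c≡k i<k }) ,
      inj₂ (share-≡ e f (inj₂ refl) (inj₁ refl) (trans b≡k (sym c≡k)))
    spokes-touch e f i<j (across refl a≡l b≡k+1) (before j<k _ _) = ⊥-elim (<-asym i<j j<k)
    spokes-touch e f i<j (across refl a≡l b≡k+1) (across refl _ _) = ⊥-elim (<-irrefl refl i<j)
    spokes-touch {j = j} e f i<j (across refl a≡l b≡k+1) (after k<j c≡k refl)
      with m≤n⇒m<n∨m≡n k<j
    ... | inj₁ k+1<j =
      (λ { refl → <-irrefl (trans (sym a≡l) c≡k) (n<1+n l) }) ,
      inj₁ (inj₁ ( inj₁ (subst₂ _<_ (sym a≡l) (sym c≡k) (n<1+n l)
                        , subst₂ _<_ (sym c≡k) (sym b≡k+1) (n<1+n k))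
                 , inj₂ (inj₂ (subst₂ _<_ (sym a≡l) (sym b≡k+1) (m<n⇒m<1+n (n<1+n l))
                              , subst (_< j) (sym b≡k+1) k+1<j))))
    ... | inj₂ k+1≡j =
      (λ { refl → <-irrefl (trans (sym a≡l) c≡k) (n<1+n l) }) ,
      inj₂ (share-≡ e f (inj₂ refl) (inj₂ refl) (trans b≡k+1 k+1≡j))
    spokes-touch e f i<j (after k<i _ _) (before j<k _ _) =
      ⊥-elim (<-asym i<j (<-trans j<k k<i))
    spokes-touch e f i<j (after k<i _ _) (across refl _ _) = ⊥-elim (<-asym i<j k<i)
    spokes-touch e f i<j (after k<i a≡k refl) (after k<j c≡k refl) =
      (λ { refl → <-irrefl refl i<j }) ,
      inj₂ (share-≡ e f (inj₁ refl) (inj₁ refl) (trans a≡k (sym c≡k)))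

  2k+1≤pages : ∀ m′ → MatchingBookEmbedding G (natural n) m′ → 2 * k + 1 ≤ m′
  2k+1≤pages = pairwise-touching-≤ (λ i → proj₁ (spokeAt i)) λ {i} {j} i<j →
    spokes-touch _ _ i<j (proj₂ (spokeAt i)) (proj₂ (spokeAt j))
    where
    spokeAt : (i : Fin (2 * k + 1)) → ∃[ e ] Spoke (toℕ i) e
    spokeAt i = spoke (toℕ i) (s≤s⁻¹ (subst (toℕ i <_) (+-comm (2 * k) 1) (toℕ<n i)))

theorem7 : (k n : ℕ) .{{_ : NonZero n}} (5≤r : 5 ≤ 2 * k + 1) (r∣n : 2 * k + 1 ∣ n) →
    IsMbt (circulant n (oneUpTo k (5≤2k+1⇒1≤k k 5≤r) (2k+1∣n⇒k≤n/2 k n r∣n)))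
    (natural n) (2 * k + 1)
theorem7 zero n (s≤s ()) r∣n
theorem7 (suc zero) n (s≤s (s≤s (s≤s ()))) r∣n
theorem7 k@(suc l@(suc _)) n 5≤r r∣n = record
  { attained = sum-colouring 1≤k k≤n/2 (2 * k + 1) k+k<r r∣n
  -- As `n` is positive, r ≤ n, so the vertices 0 to 2k used by the lower bound exist.
  ; least    = 2k+1≤pages (s≤s z≤n) k≤n/2 (<-≤-trans 2k<r (∣⇒≤ r∣n))
  }
  where
  1≤k : 1 ≤ k
  1≤k = 5≤2k+1⇒1≤k k 5≤r
  k≤n/2 : k ≤ ⌊ n /2⌋
  k≤n/2 = 2k+1∣n⇒k≤n/2 k n r∣n
  2k<r : 2 * k < 2 * k + 1
  2k<r = m<m+n (2 * k) (s≤s z≤n)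
  k+k<r : k + k < 2 * k + 1
  k+k<r = subst (λ x → k + x < 2 * k + 1) (+-identityʳ k) 2k<r
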